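{- Let $n$ and $k$ be integers such that $n \geq 3$ and $\lceil n/3 \rceil < k < n$. Then (i) $\mathcal{D}_k(P_n)$ is Eulerian if and only if $n=4$ and $k=3$; and (ii) $\mathcal{D}_k(C_n)$ is Eulerian if and only if either $n=7$ and $k=4$, or $n=3$ and $k=2$.
   Context: All graphs are finite and simple. $P_n$ and $C_n$ denote the path and the cycle on $n$ vertices, respectively. A dominating set of a graph $G$ is a set $D \subseteq V(G)$ such that every vertex of $V(G)\setminus D$ is adjacent to a vertex of $D$. The $k$-dominating graph $\mathcal{D}_k(G)$ is the graph whose vertices are the dominating sets of $G$ of cardinality at most $k$, two of them being adjacent if and only if one can be obtained from the other by adding or removing a single vertex of $G$. A graph is Eulerian if and only if every vertex has even degree and it contains at most one non-trivial component (a graph or component is trivial if it contains no edges); in particular, an Eulerian graph may have isolated vertices. -}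

module Defs where

open import Level using (0ℓ)
open import Data.Bool.Properties using () renaming (_≟_ to _≟ᵇ_)
open import Data.Fin.Base using (Fin; toℕ)
open import Data.Fin.Properties using (any?; all?)
open import Data.Fin.Subset using (Subset; inside; outside; _∈_; _∉_; _∪_; _-_; ⁅_⁆; ∣_∣)
open import Data.Fin.Subset.Properties using (_∈?_; x∈p∪q⁺; x∈⁅x⁆; x∈p⇒∣p-x∣<∣p∣)
open import Data.Irrelevant using ([_])
open import Data.List.Base as List using (List; []; _∷_; allFin; cartesianProductWith; filter; length)
open import Data.List.Membership.Propositional using () renaming (_∈_ to _∈ˡ_)
open import Data.List.Membership.Propositional.Properties using (∈-allFin; ∈-cartesianProductWith⁺)
open import Data.List.Relation.Unary.All as All using (All; []; _∷_)
open import Data.List.Relation.Unary.Any using (here; there)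
open import Data.List.Relation.Unary.AllPairs using ([]; _∷_)
open import Data.List.Relation.Unary.Unique.Propositional using (Unique)
open import Data.List.Relation.Unary.Unique.Propositional.Properties using (allFin⁺; cartesianProductWith⁺)
open import Data.Nat.Base using (ℕ; zero; suc; _+_; _≤_; _/_; s≤s)
open import Data.Nat.Divisibility using (_∣_)
open import Data.Nat.Properties using (_≟_; _≤?_; 1+n≢n; <-irrefl)
open import Data.Product.Base using (∃; ∃₂; _×_; _,_)
open import Data.Refinement using (Refinement; Refinement-syntax; value; _,_)
open import Data.Sum.Base using (_⊎_; inj₁; inj₂; swap; [_,_]′)
open import Data.Vec.Base using ([]; _∷_)
open import Data.Vec.Properties using (∷-injective; ≡-dec)
open import Relation.Binary.Construct.Closure.ReflexiveTransitive using (Star)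
open import Relation.Binary.Core using (Rel)
open import Relation.Binary.Definitions using (Decidable; Irreflexive; Symmetric)
open import Relation.Binary.PropositionalEquality using (_≡_; _≢_; refl; sym; trans; cong; subst)
open import Relation.Nullary using (¬_; yes; no; ¬?; _×-dec_; _⊎-dec_; _→-dec_)
open import Relation.Nullary.Negation using (contradiction-irr)
open import Relation.Unary as Unary using (Pred; _≐_)

-- Finite simple graphs on the vertex type V; finiteness is the duplicate-free
-- enumeration of V.

record Graph (V : Set) : Set₁ where
  infix 4 _~_ _~?_
  field
    _~_      : Rel V 0ℓ
    _~?_     : Decidable _~_
    ~-sym    : Symmetric _~_
    ~-irrefl : Irreflexive _≡_ _~_
    vertices : List V
    complete : ∀ v → v ∈ˡ vertices
    unique   : Unique vertices

module _ {V : Set} (G : Graph V) where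
  open Graph G

  degree : V → ℕ
  degree v = length (filter (v ~?_) vertices)

  Component : V → Pred V 0ℓ
  Component v = Star _~_ v

  NonTrivial : Pred V 0ℓ → Set
  NonTrivial C = ∃₂ λ v w → C v × C w × v ~ w

  -- Isolated vertices are allowed: only components with an edge must coincide.
  Eulerian : Set
  Eulerian =
    (∀ v → 2 ∣ degree v) ×
    (∀ u v → NonTrivial (Component u) → NonTrivial (Component v) →
      Component u ≐ Component v)

module _ {n : ℕ} where

  PathAdj : Rel (Fin n) 0ℓ
  PathAdj i j = toℕ j ≡ suc (toℕ i) ⊎ toℕ i ≡ suc (toℕ j)

  -- The wrap-around edge is a loop when n ≡ 1 and repeats the path edge when n ≡ 2,
  -- so Cycle below asks for 3 ≤ n.
  Next : Rel (Fin n) 0ℓ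
  Next i j = toℕ j ≡ suc (toℕ i) ⊎ (suc (toℕ i) ≡ n × toℕ j ≡ 0)

  CycleAdj : Rel (Fin n) 0ℓ
  CycleAdj i j = Next i j ⊎ Next j i

  next? : Decidable Next
  next? i j = (toℕ j ≟ suc (toℕ i)) ⊎-dec ((suc (toℕ i) ≟ n) ×-dec (toℕ j ≟ 0))

  next-irrefl : 3 ≤ n → ∀ i → ¬ Next i i
  next-irrefl _   i (inj₁ eq) = 1+n≢n (sym eq)
  next-irrefl n≥3 i (inj₂ (eq , i≡0)) with trans (cong suc (sym i≡0)) eq
  next-irrefl (s≤s ()) i (inj₂ _) | refl

Path : ∀ n → Graph (Fin n)
Path n = record
  { _~_      = PathAdj
  ; _~?_     = λ i j → (toℕ j ≟ suc (toℕ i)) ⊎-dec (toℕ i ≟ suc (toℕ j))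
  ; ~-sym    = swap
  ; ~-irrefl = λ { refl → [ (λ eq → 1+n≢n (sym eq)) , (λ eq → 1+n≢n (sym eq)) ]′ }
  ; vertices = allFin n
  ; complete = ∈-allFin
  ; unique   = allFin⁺ n
  }

Cycle : ∀ n → 3 ≤ n → Graph (Fin n)
Cycle n n≥3 = record
  { _~_      = CycleAdj
  ; _~?_     = λ i j → next? i j ⊎-dec next? j i
  ; ~-sym    = swap
  ; ~-irrefl = λ { {i} refl → [ next-irrefl n≥3 i , next-irrefl n≥3 i ]′ }
  ; vertices = allFin n
  ; complete = ∈-allFin
  ; unique   = allFin⁺ n
  }

subsets : ∀ n → List (Subset n)
subsets zero    = [] ∷ []
subsets (suc n) = cartesianProductWith _∷_ (outside ∷ inside ∷ []) (subsets n)

∈-subsets : ∀ {n} (p : Subset n) → p ∈ˡ subsets n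
∈-subsets []      = here refl
∈-subsets (s ∷ p) = ∈-cartesianProductWith⁺ _∷_ (side∈ s) (∈-subsets p)
  where
  side∈ : ∀ s → s ∈ˡ (outside ∷ inside ∷ [])
  side∈ outside = here refl
  side∈ inside  = there (here refl)

subsets-unique : ∀ n → Unique (subsets n)
subsets-unique zero    = [] ∷ []
subsets-unique (suc n) =
  cartesianProductWith⁺ _∷_ ∷-injective (((λ ()) ∷ []) ∷ [] ∷ []) (subsets-unique n)

module _ {A : Set} {P : Pred A 0ℓ} (P? : Unary.Decidable P) where

  refine : List A → List (Refinement A P)
  refine []       = []
  refine (x ∷ xs) with P? x
  ... | yes px = (x , [ px ]) ∷ refine xs
  ... | no  _  = refine xs

  ∈-refine : ∀ {xs} (r : Refinement A P) → value r ∈ˡ xs → r ∈ˡ refine xs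
  ∈-refine {x ∷ xs} r            x∈ with P? x
  ∈-refine          r            (here refl) | yes _ = here refl
  ∈-refine          r            (there x∈)  | yes _ = there (∈-refine r x∈)
  ∈-refine          (_ , [ px ]) (here refl) | no ¬px =
    contradiction-irr px ¬px
  ∈-refine          r            (there x∈)  | no _ = ∈-refine r x∈

  refine-fresh : ∀ {x xs} → All (x ≢_) xs → (r : Refinement A P) → value r ≡ x → All (r ≢_) (refine xs)
  refine-fresh []                    r eq = []
  refine-fresh {xs = y ∷ _} (x≢y ∷ x∉) r eq with P? y
  ... | yes _ = (λ { refl → x≢y (sym eq) }) ∷ refine-fresh x∉ r eq
  ... | no  _ = refine-fresh x∉ r eq

  refine-unique : ∀ {xs} → Unique xs → Unique (refine xs)
  refine-unique []                   = []
  refine-unique {x ∷ _} (x∉ ∷ u) with P? x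
  ... | yes _ = refine-fresh x∉ _ refl ∷ refine-unique u
  ... | no  _ = refine-unique u

module _ {n : ℕ} where

  _≟ˢ_ : Decidable {A = Subset n} _≡_
  _≟ˢ_ = ≡-dec _≟ᵇ_

  ObtainedFrom : Rel (Subset n) 0ℓ
  ObtainedFrom E D = ∃ λ x → (x ∉ D × E ≡ D ∪ ⁅ x ⁆) ⊎ (x ∈ D × E ≡ D - x)

  obtainedFrom? : Decidable ObtainedFrom
  obtainedFrom? E D = any? λ x →
    (¬? (x ∈? D) ×-dec (E ≟ˢ (D ∪ ⁅ x ⁆))) ⊎-dec ((x ∈? D) ×-dec (E ≟ˢ (D - x)))

  obtainedFrom-irrefl : ∀ D → ¬ ObtainedFrom D D
  obtainedFrom-irrefl D (x , inj₁ (x∉D , eq)) =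
    x∉D (subst (x ∈_) (sym eq) (x∈p∪q⁺ (inj₂ (x∈⁅x⁆ x))))
  obtainedFrom-irrefl D (x , inj₂ (x∈D , eq)) =
    <-irrefl (cong ∣_∣ (sym eq)) (x∈p⇒∣p-x∣<∣p∣ x∈D)

module _ {n : ℕ} (G : Graph (Fin n)) where
  open Graph G using (_~_; _~?_)

  Dominating : Pred (Subset n) 0ℓ
  Dominating D = ∀ v → v ∉ D → ∃ λ u → u ∈ D × v ~ u

  dominating? : Unary.Decidable Dominating
  dominating? D = all? λ v → ¬? (v ∈? D) →-dec any? λ u → (u ∈? D) ×-dec (v ~? u)

  -- The membership proof is irrelevant, so two vertices are equal exactly when
  -- they are equal as subsets.
  DominatingSet : ℕ → Set
  DominatingSet k = [ D ∈ Subset n ∣ Dominating D × ∣ D ∣ ≤ k ]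

  dominatingSet? : ∀ k → Unary.Decidable (λ D → Dominating D × ∣ D ∣ ≤ k)
  dominatingSet? k D = dominating? D ×-dec (∣ D ∣ ≤? k)

𝒟 : ∀ {n} (k : ℕ) (G : Graph (Fin n)) → Graph (DominatingSet G k)
𝒟 {n} k G = record
  { _~_      = λ D E → ObtainedFrom (value D) (value E) ⊎ ObtainedFrom (value E) (value D)
  ; _~?_     = λ D E → obtainedFrom? (value D) (value E) ⊎-dec obtainedFrom? (value E) (value D)
  ; ~-sym    = swap
  ; ~-irrefl = λ { {D} refl → [ obtainedFrom-irrefl (value D) , obtainedFrom-irrefl (value D) ]′ }
  ; vertices = refine (dominatingSet? G k) (subsets n)
  ; complete = λ D → ∈-refine (dominatingSet? G k) D (∈-subsets (value D))
  ; unique   = refine-unique (dominatingSet? G k) (subsets-unique n)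
  }

⌈_/3⌉ : ℕ → ℕ
⌈ n /3⌉ = (n + 2) / 3

{-# OPTIONS --safe #-}
module Submission where

-- The neighbours of D in 𝒟ₖ(G) are the sets obtained by toggling one vertex of G,
-- so the degree of D counts the admissible toggles.  Prefixing the block ○●○ to a
-- dominating set of Pₙ gives a dominating set of Pₙ₊₃ and of Cₙ₊₃.  Toggling the
-- centre of the block is never admissible, toggling either of its ends is admissible
-- when |D| < k and not otherwise, and the remaining toggles are admissible exactly
-- when they are for D.  Hence the parity of the degree is preserved when (n , k)
-- becomes (n + 3 , k + 1), and a few small vertices of odd degree suffice.  The three
-- Eulerian cases are checked by evaluation, connectedness by a spanning walk.

open import Defs
open import Data.Bool.Base using (not)
open import Data.Bool.Properties using (not-involutive; not-¬)
open import Data.Empty using (⊥-elim)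
open import Data.Fin.Base using (Fin; zero; suc)
open import Data.Fin.Patterns using (0F; 1F; 2F; 3F; 4F; 5F; 6F)
open import Data.Fin.Subset using (Subset; inside; outside; _∈_; _∉_; _⊆_; _∪_; _-_; ⁅_⁆; ∣_∣)
open import Data.Fin.Subset.Properties using (_∈?_; ∪-identityʳ; p─⊥≡p; drop-there; out⊆; in⊆in; ⊆-refl)
open import Data.Irrelevant using ([_])
open import Data.List.Base using (List; []; _∷_; allFin; filter; length; map; tabulate)
open import Data.List.Membership.DecPropositional using () renaming (_∈?_ to member?)
open import Data.List.Membership.Propositional using () renaming (_∈_ to _∈ˡ_)
open import Data.List.Membership.Propositional.Properties
  using (∈-allFin; ∈-filter⁺; ∈-filter⁻; ∈-map⁺; ∈-map⁻)
open import Data.List.Membership.Propositional.Properties.WithK using (unique∧set⇒bag)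
open import Data.List.Properties using (filter-≐; length-map; map-tabulate)
open import Data.List.Relation.Binary.BagAndSetEquality using (∼bag⇒↭)
open import Data.List.Relation.Binary.Permutation.Propositional.Properties using (↭-length)
open import Data.List.Relation.Unary.All as All using (All; []; _∷_; all?)
open import Data.List.Relation.Unary.Any using (here; there)
open import Data.List.Relation.Unary.Unique.Propositional using (Unique)
import Data.List.Relation.Unary.Unique.Propositional.Properties as Unique
open import Data.Nat.Base using (ℕ; zero; suc; _+_; _≤_; _<_; s≤s; s≤s⁻¹; s<s⁻¹)
open import Data.Nat.DivMod using (m/n≡1+[m∸n]/n)
open import Data.Nat.Divisibility using (_∣_; _∣?_; ∣m+n∣m⇒∣n; ∣-refl)
open import Data.Nat.Properties using (+-cancelˡ-≡; m≤m+n)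
open import Data.Product.Base using (∃; _×_; _,_; proj₁; proj₂)
open import Data.Refinement using (value; value-injective; _,_)
open import Data.Sum.Base as Sum using (_⊎_; inj₁; inj₂; [_,_]′)
open import Data.Vec.Base using ([]; _∷_; updateAt; here; there)
open import Data.Vec.Properties using (∷-injectiveˡ; ∷-injectiveʳ; updateAt-updateAt; updateAt-id; updateAt-cong)
open import Function.Base using (_∘_; id)
open import Function.Bundles using (_⇔_; mk⇔; module Equivalence)
open import Level using (0ℓ)
open import Relation.Binary.Construct.Closure.ReflexiveTransitive using (Star; ε; _◅_; _◅◅_; reverse)
open import Relation.Binary.PropositionalEquality using (_≡_; refl; sym; trans; cong; subst)
open import Relation.Nullary using (¬_; yes; no; _×-dec_)
open import Relation.Nullary.Decidable using (True; False; toWitness; toWitnessFalse; recompute)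
open import Relation.Nullary.Negation using (contradiction)
open import Relation.Unary as Unary using (Pred; _≐_)

-- Toggling one vertex of a subset.

pattern ○ = outside
pattern ● = inside

-- Adding an absent vertex and removing a present one both flip one entry of the characteristic
-- vector, so a single operation covers both clauses of `ObtainedFrom`.
toggle : ∀ {n} → Fin n → Subset n → Subset n
toggle x D = updateAt D x not

toggle-involutive : ∀ {n} (x : Fin n) D → toggle x (toggle x D) ≡ D
toggle-involutive x D =
  trans (updateAt-updateAt x D) (trans (updateAt-cong x not-involutive D) (updateAt-id x D))

toggle-injective : ∀ {n} (D : Subset n) {x y} → toggle x D ≡ toggle y D → x ≡ y
toggle-injective (s ∷ D) {zero}  {zero}  eq = refl
toggle-injective (s ∷ D) {zero}  {suc y} eq = contradiction (sym (∷-injectiveˡ eq)) (not-¬ refl)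
toggle-injective (s ∷ D) {suc x} {zero}  eq = contradiction (∷-injectiveˡ eq) (not-¬ refl)
toggle-injective (s ∷ D) {suc x} {suc y} eq = cong suc (toggle-injective D (∷-injectiveʳ eq))

∉⇒∪≡toggle : ∀ {n} (x : Fin n) {D} → x ∉ D → D ∪ ⁅ x ⁆ ≡ toggle x D
∉⇒∪≡toggle zero    {● ∷ D} x∉D = contradiction here x∉D
∉⇒∪≡toggle zero    {○ ∷ D} x∉D = cong (● ∷_) (∪-identityʳ D)
∉⇒∪≡toggle (suc x) {● ∷ D} x∉D = cong (● ∷_) (∉⇒∪≡toggle x (x∉D ∘ there))
∉⇒∪≡toggle (suc x) {○ ∷ D} x∉D = cong (○ ∷_) (∉⇒∪≡toggle x (x∉D ∘ there))

∈⇒-≡toggle : ∀ {n} (x : Fin n) {D} → x ∈ D → D - x ≡ toggle x D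
∈⇒-≡toggle zero    {● ∷ D} x∈D         = cong (○ ∷_) (p─⊥≡p D)
∈⇒-≡toggle (suc x) {s ∷ D} (there x∈D) = cong (s ∷_) (∈⇒-≡toggle x x∈D)

obtainedFrom⇒toggle : ∀ {n} {D E : Subset n} → ObtainedFrom E D → ∃ λ x → E ≡ toggle x D
obtainedFrom⇒toggle (x , inj₁ (x∉D , eq)) = x , trans eq (∉⇒∪≡toggle x x∉D)
obtainedFrom⇒toggle (x , inj₂ (x∈D , eq)) = x , trans eq (∈⇒-≡toggle x x∈D)

toggle-obtainedFrom : ∀ {n} (x : Fin n) D → ObtainedFrom (toggle x D) D
toggle-obtainedFrom x D with x ∈? D
... | yes x∈D = x , inj₂ (x∈D , sym (∈⇒-≡toggle x x∈D))
... | no  x∉D = x , inj₁ (x∉D , sym (∉⇒∪≡toggle x x∉D))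

-- Degrees as counts of admissible toggles.

unique-set⇒length : ∀ {A : Set} {xs ys : List A} → Unique xs → Unique ys →
  (∀ {x} → x ∈ˡ xs ⇔ x ∈ˡ ys) → length xs ≡ length ys
unique-set⇒length xs! ys! xs∼ys = ↭-length (∼bag⇒↭ (unique∧set⇒bag xs! ys! xs∼ys))

length-filter-map : ∀ {A B : Set} {P : Pred B 0ℓ} (P? : Unary.Decidable P) (f : A → B) xs →
  length (filter P? (map f xs)) ≡ length (filter (P? ∘ f) xs)
length-filter-map P? f []       = refl
length-filter-map P? f (x ∷ xs) with P? (f x)
... | yes _ = cong suc (length-filter-map P? f xs)
... | no  _ = length-filter-map P? f xs

module _ {n : ℕ} (G : Graph (Fin n)) where

  -- Runs over the `n` vertices of `G`, not over the list of all subsets, and takes a bare subset,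
  -- so that parities can be evaluated directly.
  toggles : ℕ → Subset n → ℕ
  toggles k D = length (filter (λ x → dominatingSet? G k (toggle x D)) (allFin n))

  module _ (k : ℕ) where

    open Graph (𝒟 k G) using (_~_; _~?_; vertices; complete; unique)

    -- The membership proof is irrelevant; decidability of the property makes it usable again.
    isDominatingSet : (D : DominatingSet G k) → Dominating G (value D) × ∣ value D ∣ ≤ k
    isDominatingSet (D , [ d ]) = recompute (dominatingSet? G k D) d

    ~⇒toggle : ∀ {D E} → D ~ E → ∃ λ x → value E ≡ toggle x (value D)
    ~⇒toggle (inj₂ E←D) = obtainedFrom⇒toggle E←D
    ~⇒toggle {D} {E} (inj₁ D←E) with obtainedFrom⇒toggle D←E
    ... | x , eq = x , sym (trans (cong (toggle x) eq) (toggle-involutive x (value E)))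

    -- Seen as lists of subsets, the neighbours and the admissible toggles are both duplicate-free,
    -- by injectivity of `value` and of toggling, and have the same members. Hence their lengths
    -- agree.
    degree≡toggles : ∀ D → degree (𝒟 k G) D ≡ toggles k (value D)
    degree≡toggles D = trans (sym (length-map value neighbours))
      (trans (unique-set⇒length
               (Unique.map⁺ value-injective (Unique.filter⁺ (D ~?_) unique))
               (Unique.map⁺ (toggle-injective (value D)) (Unique.filter⁺ admissible? (Unique.allFin⁺ n)))
               (mk⇔ to from))
             (length-map toggled (filter admissible? (allFin n))))
      where
      toggled : Fin n → Subset n
      toggled x = toggle x (value D)

      admissible? : Unary.Decidable (λ x → Dominating G (toggled x) × ∣ toggled x ∣ ≤ k)
      admissible? x = dominatingSet? G k (toggled x)

      neighbours : List (DominatingSet G k)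
      neighbours = filter (D ~?_) vertices

      to : ∀ {E} → E ∈ˡ map value neighbours → E ∈ˡ map toggled (filter admissible? (allFin n))
      to E∈ with ∈-map⁻ value E∈
      ... | E , E∈ns , refl with ~⇒toggle {D} {E} (proj₂ (∈-filter⁻ (D ~?_) {xs = vertices} E∈ns))
      ... | x , eq = subst (_∈ˡ _) (sym eq) (∈-map⁺ toggled (∈-filter⁺ admissible? (∈-allFin x)
                       (subst (λ E → Dominating G E × ∣ E ∣ ≤ k) eq (isDominatingSet E))))

      from : ∀ {E} → E ∈ˡ map toggled (filter admissible? (allFin n)) → E ∈ˡ map value neighbours
      from E∈ with ∈-map⁻ toggled E∈
      ... | x , x∈ , refl = ∈-map⁺ value (∈-filter⁺ (D ~?_) (complete E′) (inj₂ (toggle-obtainedFrom x (value D))))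
        where
        E′ : DominatingSet G k
        E′ = toggled x , [ proj₂ (∈-filter⁻ admissible? {xs = allFin n} x∈) ]

    OddVertex : Set
    OddVertex = ∃ λ D → (Dominating G D × ∣ D ∣ ≤ k) × ¬ 2 ∣ toggles k D

    oddVertex⇒¬eulerian : OddVertex → ¬ Eulerian (𝒟 k G)
    oddVertex⇒¬eulerian (D , d , odd) (even , _) =
      odd (subst (2 ∣_) (degree≡toggles (D , [ d ])) (even (D , [ d ])))

    -- Both conditions are implicit and settled by evaluation, so a concrete odd vertex is given by
    -- its subset alone.
    oddVertex : ∀ D → {True (dominatingSet? G k D)} → {False (2 ∣? toggles k D)} → OddVertex
    oddVertex D {d} {odd} = D , toWitness d , toWitnessFalse odd

-- Connectedness by spanning walks.

trail : ∀ {n} → Subset n → List (Fin n) → List (Subset n)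
trail D []       = []
trail D (x ∷ xs) = toggle x D ∷ trail (toggle x D) xs

module _ {n : ℕ} (G : Graph (Fin n)) (k : ℕ) where

  open Graph (𝒟 k G) using (_~_; ~-sym; vertices; complete)

  trail-connected : ∀ {D} xs → All (λ E → Dominating G E × ∣ E ∣ ≤ k) (trail (value D) xs) →
    ∀ {E} → value E ∈ˡ value D ∷ trail (value D) xs → Star _~_ D E
  trail-connected {D} xs       _        {E} (here eq)  = subst (Star _~_ D) (value-injective (sym eq)) ε
  trail-connected {D} (x ∷ xs) (d ∷ ds) {E} (there E∈) =
    inj₂ (toggle-obtainedFrom x (value D)) ◅ trail-connected {toggle x (value D) , [ d ]} xs ds {E} E∈

  -- If a walk from `D` through admissible sets meets every vertex, any two vertices are joined
  -- through `D`, so all components coincide. Evaluation checks the walk and the parities.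
  eulerian : ∀ D xs → {True (all? (dominatingSet? G k) (D ∷ trail D xs))} →
    {True (all? (λ E → (2 ∣? toggles G k (value E)) ×-dec (member? _≟ˢ_ (value E) (D ∷ trail D xs))) vertices)} →
    Eulerian (𝒟 k G)
  eulerian D xs {admissible} {spanning} with toWitness admissible | toWitness spanning
  ... | d ∷ ds | checked = even , λ u v _ _ → (path v u ◅◅_) , (path u v ◅◅_)
    where
    even : ∀ E → 2 ∣ degree (𝒟 k G) E
    even E = subst (2 ∣_) (sym (degree≡toggles G k E)) (proj₁ (All.lookup checked (complete E)))

    fromRoot : ∀ E → Star _~_ (D , [ d ]) E
    fromRoot E = trail-connected xs ds (proj₂ (All.lookup checked (complete E)))

    path : ∀ u v → Star _~_ u v
    path u v = reverse (λ {D} {E} → ~-sym {D} {E}) (fromRoot u) ◅◅ fromRoot v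

-- Prefixing a block and the parity of degrees.

Dominating-⊆ : ∀ {n} (G : Graph (Fin n)) {D E} → D ⊆ E → Dominating G D → Dominating G E
Dominating-⊆ G D⊆E dom v v∉E with dom v (v∉E ∘ D⊆E)
... | u , u∈D , v~u = u , D⊆E u∈D , v~u

length-filter-shift : ∀ {n} {P : Pred (Fin (3 + n)) 0ℓ} {Q : Pred (Fin n) 0ℓ}
  (P? : Unary.Decidable P) (Q? : Unary.Decidable Q) → (λ x → P (suc (suc (suc x)))) ≐ Q →
  length (filter P? (tabulate (λ x → suc (suc (suc x))))) ≡ length (filter Q? (allFin n))
length-filter-shift {n} P? Q? P≐Q =
  trans (cong (length ∘ filter P?) (sym (map-tabulate id (λ x → suc (suc (suc x))))))
  (trans (length-filter-map P? (λ x → suc (suc (suc x))) (allFin n))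
         (cong length (filter-≐ (λ x → P? (suc (suc (suc x)))) Q? P≐Q (allFin n))))

-- The indices `0F` and `2F` together contribute 0 or 2, `1F` contributes nothing, and the remaining
-- indices contribute the count for `Q`.
odd-filter-allFin : ∀ {n} {P : Pred (Fin (3 + n)) 0ℓ} {Q : Pred (Fin n) 0ℓ}
  (P? : Unary.Decidable P) (Q? : Unary.Decidable Q) →
  P 0F ⇔ P 2F → ¬ P 1F → (λ x → P (suc (suc (suc x)))) ≐ Q →
  ¬ 2 ∣ length (filter Q? (allFin n)) → ¬ 2 ∣ length (filter P? (allFin (3 + n)))
odd-filter-allFin P? Q? P₀⇔P₂ ¬P₁ P≐Q odd with P? 0F
... | yes p₀ with P? 1F
...   | yes p₁ = contradiction p₁ ¬P₁
...   | no _ with P? 2F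
...     | yes _  = λ even → odd (subst (2 ∣_) (length-filter-shift P? Q? P≐Q) (∣m+n∣m⇒∣n even ∣-refl))
...     | no ¬p₂ = contradiction (Equivalence.to P₀⇔P₂ p₀) ¬p₂
odd-filter-allFin P? Q? P₀⇔P₂ ¬P₁ P≐Q odd | no ¬p₀ with P? 1F
...   | yes p₁ = contradiction p₁ ¬P₁
...   | no _ with P? 2F
...     | yes p₂ = contradiction (Equivalence.from P₀⇔P₂ p₂) ¬p₀
...     | no _   = odd ∘ subst (2 ∣_) (length-filter-shift P? Q? P≐Q)

-- Isolates what the block argument asks of a pair of graphs, so that it serves both for lengthening
-- a path and for closing a path into a cycle.
record Extends {n : ℕ} (G : Graph (Fin n)) (H : Graph (Fin (3 + n))) : Set where
  field
    block⁺ : ∀ {D} → Dominating G D → Dominating H (○ ∷ ● ∷ ○ ∷ D)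
    block⁻ : ∀ {D} → Dominating H (○ ∷ ● ∷ ○ ∷ D) → Dominating G D
    centre : ∀ {D} → ¬ Dominating H (○ ∷ ○ ∷ ○ ∷ D)

module _ {n : ℕ} {G : Graph (Fin n)} {H : Graph (Fin (3 + n))} (ext : Extends G H) where

  open Extends ext

  block-toggles : ∀ {k D} → Dominating G D → ¬ 2 ∣ toggles G k D →
    ¬ 2 ∣ toggles H (suc k) (○ ∷ ● ∷ ○ ∷ D)
  block-toggles {k} {D} dom =
    odd-filter-allFin
      (λ x → dominatingSet? H (suc k) (toggle x (○ ∷ ● ∷ ○ ∷ D)))
      (λ x → dominatingSet? G k (toggle x D))
      -- Toggling either end yields a superset of a dominating set, and both results have size 2 +
      -- |D|, so the size bound is passed on unchanged.
      (mk⇔ (λ (_ , ≤k) → Dominating-⊆ H (out⊆ (in⊆in (out⊆ ⊆-refl))) (block⁺ dom) , ≤k)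
           (λ (_ , ≤k) → Dominating-⊆ H (out⊆ (in⊆in (out⊆ ⊆-refl))) (block⁺ dom) , ≤k))
      (centre ∘ proj₁)
      ((λ (d , ≤k) → block⁻ d , s≤s⁻¹ ≤k) , (λ (d , ≤k) → block⁺ d , s≤s ≤k))

  block-oddVertex : ∀ {k} → OddVertex G k → OddVertex H (suc k)
  block-oddVertex (D , (dom , ≤k) , odd) =
    ○ ∷ ● ∷ ○ ∷ D , (block⁺ dom , s≤s ≤k) , block-toggles dom odd

-- Paths and cycles as extensions of paths.

Path-extends : ∀ {n} → Extends (Path n) (Path (3 + n))
Path-extends {n} = record { block⁺ = block⁺ ; block⁻ = block⁻ ; centre = centre }
  where
  block⁺ : ∀ {D} → Dominating (Path n) D → Dominating (Path (3 + n)) (○ ∷ ● ∷ ○ ∷ D)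
  block⁺ dom 0F _ = 1F , there here , inj₁ refl
  block⁺ dom 1F 1∉ = contradiction (there here) 1∉
  block⁺ dom 2F _ = 1F , there here , inj₂ refl
  block⁺ dom (suc (suc (suc v))) v∉ with dom v (λ v∈ → v∉ (there (there (there v∈))))
  ... | u , u∈ , v~u = suc (suc (suc u)) , there (there (there u∈)) , Sum.map (cong (3 +_)) (cong (3 +_)) v~u

  block⁻ : ∀ {D} → Dominating (Path (3 + n)) (○ ∷ ● ∷ ○ ∷ D) → Dominating (Path n) D
  block⁻ dom v v∉ with dom (suc (suc (suc v))) (v∉ ∘ drop-there ∘ drop-there ∘ drop-there)
  -- The occupied centre is not adjacent to anything beyond the block, and the ends of the block are
  -- unoccupied, so the dominating vertex lies in `D`.
  ... | 1F , _ , inj₁ ()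
  ... | 1F , _ , inj₂ ()
  ... | 2F , there (there ()) , _
  ... | suc (suc (suc u)) , there (there (there u∈)) , v~u =
    u , u∈ , Sum.map (+-cancelˡ-≡ 3 _ _) (+-cancelˡ-≡ 3 _ _) v~u

  centre : ∀ {D} → ¬ Dominating (Path (3 + n)) (○ ∷ ○ ∷ ○ ∷ D)
  centre dom with dom 1F (λ { (there ()) })
  ... | 1F , there () , _
  ... | 2F , there (there ()) , _
  ... | suc (suc (suc _)) , _ , inj₁ ()
  ... | suc (suc (suc _)) , _ , inj₂ ()

Path⇒CycleAdj : ∀ {n} {i j : Fin n} → PathAdj i j → CycleAdj i j
Path⇒CycleAdj = Sum.map inj₁ inj₁

-- Deleting the block from the cycle leaves a path. Since `0F` and `2F` are unoccupied, the block
-- dominates nothing outside itself, even along the wrap-around edge.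
Cycle-extends : ∀ {n} (3≤ : 3 ≤ 3 + n) → Extends (Path n) (Cycle (3 + n) 3≤)
Cycle-extends {n} 3≤ = record { block⁺ = block⁺ ; block⁻ = block⁻ ; centre = centre }
  where
  block⁺ : ∀ {D} → Dominating (Path n) D → Dominating (Cycle (3 + n) 3≤) (○ ∷ ● ∷ ○ ∷ D)
  block⁺ dom v v∉ with Extends.block⁺ Path-extends dom v v∉
  ... | u , u∈ , v~u = u , u∈ , Path⇒CycleAdj v~u

  block⁻ : ∀ {D} → Dominating (Cycle (3 + n) 3≤) (○ ∷ ● ∷ ○ ∷ D) → Dominating (Path n) D
  block⁻ dom v v∉ with dom (suc (suc (suc v))) (v∉ ∘ drop-there ∘ drop-there ∘ drop-there)
  ... | 1F , _ , inj₁ (inj₁ ())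
  ... | 1F , _ , inj₁ (inj₂ ())
  ... | 1F , _ , inj₂ (inj₁ ())
  ... | 1F , _ , inj₂ (inj₂ ())
  ... | 2F , there (there ()) , _
  -- The wrap-around edge ends at `0F`, so beyond the block only path edges remain.
  ... | suc (suc (suc u)) , there (there (there u∈)) , inj₁ (inj₁ eq) = u , u∈ , inj₁ (+-cancelˡ-≡ 3 _ _ eq)
  ... | suc (suc (suc u)) , there (there (there u∈)) , inj₂ (inj₁ eq) = u , u∈ , inj₂ (+-cancelˡ-≡ 3 _ _ eq)

  centre : ∀ {D} → ¬ Dominating (Cycle (3 + n) 3≤) (○ ∷ ○ ∷ ○ ∷ D)
  centre dom with dom 1F (λ { (there ()) })
  ... | 1F , there () , _
  ... | 2F , there (there ()) , _
  ... | suc (suc (suc _)) , _ , inj₁ (inj₁ ())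
  ... | suc (suc (suc _)) , _ , inj₂ (inj₁ ())
  ... | suc (suc (suc _)) , _ , inj₂ (inj₂ ())

-- Small odd vertices and the case analysis.

⌈3+n/3⌉ : ∀ n → ⌈ 3 + n /3⌉ ≡ suc ⌈ n /3⌉
⌈3+n/3⌉ n = m/n≡1+[m∸n]/n (m≤m+n 3 (n + 2))

-- The bound is at least the order of the path, so every size test succeeds and the count evaluates
-- with `k` left open.
P₂-odd : ∀ k → OddVertex (Path 2) (2 + k)
P₂-odd k = oddVertex (Path 2) (2 + k) (● ∷ ○ ∷ [])

P₄-odd : ∀ k → OddVertex (Path 4) (4 + k)
P₄-odd k = oddVertex (Path 4) (4 + k) (● ∷ ● ∷ ● ∷ ○ ∷ [])

P₃-odd : OddVertex (Path 3) 2
P₃-odd = oddVertex (Path 3) 2 (● ∷ ● ∷ ○ ∷ [])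

-- Induction in steps of three from the orders 5, 6 and 7. It starts above 4 because the path on 4
-- vertices with bound 3 has no odd vertex.
path-odd : ∀ m k → ⌈ 5 + m /3⌉ < k → OddVertex (Path (5 + m)) k
path-odd 0 _ (s≤s (s≤s (s≤s {n = k} _))) = block-oddVertex Path-extends (P₂-odd k)
path-odd 1 _ (s≤s (s≤s (s≤s {n = zero} _))) = block-oddVertex Path-extends P₃-odd
-- The three absent vertices can each be added, and no present vertex can be removed.
path-odd 1 _ (s≤s (s≤s (s≤s {n = suc k} _))) = oddVertex (Path 6) (4 + k) (● ∷ ○ ∷ ● ∷ ○ ∷ ● ∷ ○ ∷ [])
-- Removing a block would lead to the Eulerian case of order 4 and bound 3. Here the size bound is
-- attained, and `0F` is the only vertex that can be removed.
path-odd 2 _ (s≤s (s≤s (s≤s (s≤s {n = zero} _)))) = oddVertex (Path 7) 4 (● ∷ ● ∷ ○ ∷ ○ ∷ ● ∷ ● ∷ ○ ∷ [])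
path-odd 2 _ (s≤s (s≤s (s≤s (s≤s {n = suc k} _)))) = block-oddVertex Path-extends (P₄-odd k)
-- The bound `k` and the ceiling both drop by one, so the strict inequality survives.
path-odd (suc (suc (suc m))) (suc k) γ<k =
  block-oddVertex Path-extends (path-odd m k (s<s⁻¹ (subst (_< suc k) (⌈3+n/3⌉ (5 + m)) γ<k)))

path-not-eulerian : ∀ n k → 3 ≤ n → ⌈ n /3⌉ < k → k < n → Eulerian (𝒟 k (Path n)) → n ≡ 4 × k ≡ 3
path-not-eulerian 0 _ () _ _
path-not-eulerian 1 _ (s≤s ()) _ _
path-not-eulerian 2 _ (s≤s (s≤s ())) _ _
path-not-eulerian 3 2 _ _ _ = ⊥-elim ∘ oddVertex⇒¬eulerian (Path 3) 2 P₃-odd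
path-not-eulerian 3 (suc (suc (suc k))) _ _ (s≤s (s≤s (s≤s ())))
path-not-eulerian 3 1 _ (s≤s ()) _
path-not-eulerian 4 1 _ (s≤s ()) _
path-not-eulerian 4 2 _ (s≤s (s≤s ())) _
path-not-eulerian 4 3 _ _ _ _ = refl , refl
path-not-eulerian 4 (suc (suc (suc (suc k)))) _ _ (s≤s (s≤s (s≤s (s≤s ()))))
path-not-eulerian (suc (suc (suc (suc (suc m))))) k _ γ<k _ =
  ⊥-elim ∘ oddVertex⇒¬eulerian (Path (5 + m)) k (path-odd m k γ<k)

-- From order 8 on, a block reduces the cycle to a path of order at least 5, covered by `path-odd`;
-- smaller orders are treated one by one.
cycle-odd : ∀ n k (n≥3 : 3 ≤ n) → ⌈ n /3⌉ < k → k < n →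
  ((n ≡ 7 × k ≡ 4) ⊎ (n ≡ 3 × k ≡ 2)) ⊎ OddVertex (Cycle n n≥3) k
cycle-odd 0 _ () _ _
cycle-odd 1 _ (s≤s ()) _ _
cycle-odd 2 _ (s≤s (s≤s ())) _ _
cycle-odd 3 1 _ (s≤s ()) _
cycle-odd 3 2 _ _ _ = inj₁ (inj₂ (refl , refl))
cycle-odd 3 (suc (suc (suc k))) _ _ (s≤s (s≤s (s≤s ())))
cycle-odd 4 1 _ (s≤s ()) _
cycle-odd 4 2 _ (s≤s (s≤s ())) _
-- The size bound is attained, and each of the three vertices can be removed, since any two vertices
-- dominate this cycle.
cycle-odd 4 3 n≥3 _ _ = inj₂ (oddVertex (Cycle 4 n≥3) 3 (● ∷ ● ∷ ● ∷ ○ ∷ []))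
cycle-odd 4 (suc (suc (suc (suc k)))) _ _ (s≤s (s≤s (s≤s (s≤s ()))))
cycle-odd 5 _ n≥3 (s≤s (s≤s (s≤s {n = k} _))) _ = inj₂ (block-oddVertex (Cycle-extends n≥3) (P₂-odd k))
cycle-odd 6 _ n≥3 (s≤s (s≤s (s≤s {n = zero} _))) _ = inj₂ (block-oddVertex (Cycle-extends n≥3) P₃-odd)
cycle-odd 6 _ n≥3 (s≤s (s≤s (s≤s {n = suc k} _))) _ =
  inj₂ (oddVertex (Cycle 6 n≥3) (4 + k) (● ∷ ○ ∷ ● ∷ ○ ∷ ● ∷ ○ ∷ []))
cycle-odd 7 _ n≥3 (s≤s (s≤s (s≤s (s≤s {n = zero} _)))) _ = inj₁ (inj₁ (refl , refl))
cycle-odd 7 _ n≥3 (s≤s (s≤s (s≤s (s≤s {n = suc k} _)))) _ = inj₂ (block-oddVertex (Cycle-extends n≥3) (P₄-odd k))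
cycle-odd (suc (suc (suc n@(suc (suc (suc (suc (suc m)))))))) (suc k) n≥3 γ<k _ =
  inj₂ (block-oddVertex (Cycle-extends n≥3) (path-odd m k (s<s⁻¹ (subst (_< suc k) (⌈3+n/3⌉ n) γ<k))))

-- The Eulerian cases and the two equivalences.

C₇-eulerian : ∀ n≥3 → Eulerian (𝒟 4 (Cycle 7 n≥3))
C₇-eulerian n≥3 = eulerian (Cycle 7 n≥3) 4 (○ ∷ ● ∷ ● ∷ ○ ∷ ● ∷ ● ∷ ○ ∷ [])
  -- Fewer than three vertices never dominate this cycle, so the walk alternates between sizes 4 and
  -- 3; it meets some sets more than once.
  (4F ∷ 0F ∷ 1F ∷ 4F ∷ 5F ∷ 6F ∷ 0F ∷ 3F ∷ 4F ∷ 0F ∷ 2F ∷ 1F ∷ 0F ∷ 4F ∷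
   3F ∷ 0F ∷ 6F ∷ 5F ∷ 0F ∷ 3F ∷ 4F ∷ 6F ∷ 5F ∷ 2F ∷ 1F ∷ 5F ∷ 3F ∷ 1F ∷
   6F ∷ 3F ∷ 2F ∷ 0F ∷ 1F ∷ 4F ∷ 5F ∷ 1F ∷ 3F ∷ 2F ∷ 1F ∷ 3F ∷ 2F ∷ 6F ∷
   4F ∷ 5F ∷ 6F ∷ 2F ∷ 3F ∷ 6F ∷ 0F ∷ 4F ∷ 5F ∷ 1F ∷ 2F ∷ 5F ∷ [])

theorem8 : (n k : ℕ) (n≥3 : 3 ≤ n) → ⌈ n /3⌉ < k → k < n →
    (Eulerian (𝒟 k (Path n)) ⇔ (n ≡ 4 × k ≡ 3)) ×
    (Eulerian (𝒟 k (Cycle n n≥3)) ⇔ ((n ≡ 7 × k ≡ 4) ⊎ (n ≡ 3 × k ≡ 2)))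
theorem8 n k n≥3 γ<k k<n =
  mk⇔ (path-not-eulerian n k n≥3 γ<k k<n)
      -- This dominating graph is a cycle of length 8, traversed once around. The case of order 3
      -- below is likewise a cycle of length 6.
      (λ { (refl , refl) → eulerian (Path 4) 3 (○ ∷ ● ∷ ● ∷ ○ ∷ []) (3F ∷ 2F ∷ 0F ∷ 1F ∷ 2F ∷ 3F ∷ 1F ∷ []) }) ,
  mk⇔ (λ e → [ id , (λ odd → contradiction e (oddVertex⇒¬eulerian (Cycle n n≥3) k odd)) ]′
         (cycle-odd n k n≥3 γ<k k<n))
      λ { (inj₁ (refl , refl)) → C₇-eulerian n≥3
        ; (inj₂ (refl , refl)) → eulerian (Cycle 3 n≥3) 2 (● ∷ ○ ∷ ○ ∷ []) (2F ∷ 0F ∷ 1F ∷ 2F ∷ 0F ∷ []) }
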